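{- Every hypergame $x$ has a non-losing strategy for at least one of the players L, R, I, II.
   Context: Hypergames: work in a universe of possibly non-wellfounded sets (set theory with the Antifoundation Axiom, and the Axiom of Choice). The class $\mathcal H$ of hypergames (also called games) is the carrier of the final coalgebra $(\mathcal H,\mathrm{id})$ of the functor $F(A)=\mathcal P(A)\times\mathcal P(A)$ on the category of classes and functional classes, where $\mathcal P$ is the powerset functor. Thus a hypergame is a pair $x=(X^L,X^R)$ of sets of hypergames; elements $x^L\in X^L$ and $x^R\in X^R$ are the Left and Right options of $x$. Positions of $x$ are the hypergames hereditarily reachable from $x$. Plays: L (Left) and R (Right) move alternately; either may start. Player I is the one who starts, player II the other one; LI means L acting as player I, and similarly LII, RI, RII. A play on $x$ is a (possibly empty) finite or infinite sequence $x_1^{K_1}x_2^{K_2}\cdots$ with $K_i\in\{L,R\}$ and $K_{i+1}\neq K_i$, such that, with $x_0=x$ and $x_i=(X_i^L,X_i^R)$, one has $x_{i+1}\in X_i^{K_{i+1}}$ for all $i\ge 0$. A finite play is winning for L (resp. R) if it ends with a position $y=(Y^L,Y^R)$ where R (resp. L) is next to move but $Y^R=\emptyset$ (resp. $Y^L=\emptyset$); the empty play ends at $x$ with the starting player next to move. Every infinite play is a draw. A play is non-losing for L (resp. R) if it is winning for L (resp. R) or is a draw. Strategies: for P in $\{$LI, LII, RI, RII$\}$ let $\mathrm{FPlay}^P_x$ be the set of finite plays on $x$ in which P has the prescribed role (first or second player) and is next to move (the empty play is included exactly when P is LI or RI). A strategy for P on $x$ is a partial function $f$ from $\mathrm{FPlay}^P_x$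 to positions of $x$ such that $f(\pi)=x'$ implies that $\pi x'$ is a play, and $f(\pi)$ is defined whenever some $\pi x'$ is a play. The opponent of LI is RII, and of LII is RI (and conversely). A play $\pi$ is coherent with $f$ if for each proper prefix $\pi'$ of $\pi$ where P is next to move, $f(\pi')=x'$ implies $\pi'x'$ is a prefix of $\pi$. For a strategy $f$ for P and a strategy $f'$ for the opponent, $f*f'$ is the unique maximal play coherent with both. $f$ is non-losing (winning) for P if $f*f'$ is non-losing (winning) for P (i.e. for L or R accordingly) for every strategy $f'$ of the opponent. A strategy for L is a pair of strategies for LI and LII; for R, for RI and RII; for I, for LI and RI; for II, for LII and RII. Such a pair is non-losing (winning) if both components are. -}

module Defs where

open import Axiom.ExcludedMiddle using (ExcludedMiddle)
open import Data.Empty.Polymorphic using (⊥)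
open import Data.List.Base using (List; []; _∷_; _∷ʳ_; length; applyUpTo)
open import Data.List.Properties using (applyUpTo-∷ʳ; length-applyUpTo; length-++)
open import Data.List.Relation.Binary.Pointwise as Pointwise using (Pointwise; []; _∷_; Pointwise-length)
open import Data.List.Relation.Binary.Prefix.Heterogeneous using (Prefix; []; _∷_)
open import Data.List.Relation.Binary.Prefix.Heterogeneous.Properties using (length-mono)
open import Data.Nat.Base using (ℕ; zero; suc; _≤_)
open import Data.Nat.Properties using (+-comm; n<1+n; <⇒≱)
open import Data.Product using (Σ; Σ-syntax; ∃; ∃-syntax; ∃!; _×_; _,_; proj₁; proj₂)
open import Data.Sum.Base using (_⊎_; inj₁; inj₂)
open import Data.Unit.Polymorphic using (⊤; tt)
open import Function.Bundles using (Func)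
open import Level using (Level; _⊔_) renaming (suc to lsuc)
open import Relation.Binary.Bundles using (Setoid)
open import Relation.Binary.Core using (REL; Rel)
open import Relation.Binary.PropositionalEquality using (_≡_; refl; sym; trans; cong; subst)
open import Relation.Nullary using (¬_; yes; no; contradiction)
open import Relation.Unary using (Pred; Empty)

private
  variable
    ℓ : Level

------------------------------------------------------------------------
-- The axiom of choice

-- A set is a setoid here, so the choice function has to respect the equalities;
-- without that requirement the statement would be a triviality of type theory.
AxiomOfChoice : ∀ c r → Set (lsuc c ⊔ lsuc r)
AxiomOfChoice c r =
  (A B : Setoid c r) →
  let module A = Setoid A
      module B = Setoid B in
  (T : REL A.Carrier B.Carrier r) →
  (∀ {a a′ b b′} → a A.≈ a′ → b B.≈ b′ → T a b → T a′ b′) →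
  (∀ a → ∃[ b ] T a b) →
  Σ[ h ∈ Func A B ] (∀ a → T a (Func.to h a))

------------------------------------------------------------------------
-- Hypergames

data Side : Set where
  L R : Side

other : Side → Side
other L = R
other R = L

-- Aczel's description of the final coalgebra of F(A) = 𝒫(A) × 𝒫(A) on
-- classes: its elements are the pointed small F-coalgebras, and two of them
-- are equal when they are bisimilar.  Small means in Set ℓ.  `Opt L` and
-- `Opt R` are the two components of the structure map
-- Node → 𝒫(Node) × 𝒫(Node).
record Hypergame (ℓ : Level) : Set (lsuc ℓ) where
  field
    Node : Set ℓ
    Opt  : Side → Node → Pred Node ℓ
    root : Node

open Hypergame public

_at_ : (x : Hypergame ℓ) → Node x → Hypergame ℓ
x at n = record x { root = n }

IsBisimulation : (x y : Hypergame ℓ) → REL (Node x) (Node y) ℓ → Set ℓ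
IsBisimulation x y B = ∀ {n m} → B n m → ∀ K →
  (∀ {n′} → Opt x K n n′ → ∃[ m′ ] (Opt y K m m′ × B n′ m′)) ×
  (∀ {m′} → Opt y K m m′ → ∃[ n′ ] (Opt x K n n′ × B n′ m′))

infix 4 _≈_ _≋_ _⊑_ _⊏_

-- Equality of hypergames.
_≈_ : Rel (Hypergame ℓ) (lsuc ℓ)
_≈_ {ℓ} x y =
  Σ[ B ∈ REL (Node x) (Node y) ℓ ] (IsBisimulation x y B × B (root x) (root y))

-- The set Xᴷ of K-options of x = (Xᴸ , Xᴿ).
options : Side → Hypergame ℓ → Pred (Hypergame ℓ) (lsuc ℓ)
options K x y = ∃[ n ] (Opt x K (root x) n × y ≈ x at n)

------------------------------------------------------------------------
-- Plays

data Turn : Set where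
  I II : Turn

-- LI, LII, RI, RII.
Role : Set
Role = Side × Turn

side : Role → Side
side = proj₁

opponent : Role → Role
opponent (K , I)  = other K , II
opponent (K , II) = other K , I

starter : Role → Side
starter (K , I)  = K
starter (K , II) = other K

-- A sequence x₁x₂⋯ of positions.  The labels Kᵢ are not stored: they alternate,
-- so they are determined by the side K₁ that starts, which is a parameter
-- of everything below.  It has to be given for the empty play anyway.
data Sequence (ℓ : Level) : Set (lsuc ℓ) where
  fin : List (Hypergame ℓ) → Sequence ℓ
  inf : (ℕ → Hypergame ℓ) → Sequence ℓ

toMove : Side → List (Hypergame ℓ) → Side
toMove K []      = K
toMove K (_ ∷ π) = toMove (other K) π

end : Hypergame ℓ → List (Hypergame ℓ) → Hypergame ℓ
end x []      = x
end _ (y ∷ π) = end y π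

data IsFinitePlay {ℓ} (x : Hypergame ℓ) (K : Side) : List (Hypergame ℓ) → Set (lsuc ℓ) where
  []  : IsFinitePlay x K []
  _∷_ : ∀ {y π} → options K x y → IsFinitePlay y (other K) π → IsFinitePlay x K (y ∷ π)

IsPlay : Hypergame ℓ → Side → Sequence ℓ → Set (lsuc ℓ)
IsPlay x K (fin π) = IsFinitePlay x K π
IsPlay x K (inf σ) = ∀ n → IsFinitePlay x K (applyUpTo σ n)

_⊑_ : Rel (Sequence ℓ) (lsuc ℓ)
fin π ⊑ fin ρ = Prefix _≈_ π ρ
fin π ⊑ inf σ = Pointwise _≈_ π (applyUpTo σ (length π))
inf _ ⊑ fin _ = ⊥
inf σ ⊑ inf τ = ∀ n → σ n ≈ τ n

_⊏_ : Rel (Sequence ℓ) (lsuc ℓ)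
π ⊏ ρ = π ⊑ ρ × ¬ ρ ⊑ π

-- Equality of sequences.
_≋_ : Rel (Sequence ℓ) (lsuc ℓ)
π ≋ ρ = π ⊑ ρ × ρ ⊑ π

-- `IsWinning x S K π`: the play π on x, started by S, is winning for K.
IsWinning : Hypergame ℓ → Side → Side → Sequence ℓ → Set (lsuc ℓ)
IsWinning {ℓ} x S K (fin π) =
  toMove S π ≡ other K × Empty (options (other K) (end x π))
IsWinning x S K (inf _) = ⊥

IsDraw : Sequence ℓ → Set (lsuc ℓ)
IsDraw (fin _) = ⊥
IsDraw (inf _) = ⊤

IsNonLosing : Hypergame ℓ → Side → Side → Sequence ℓ → Set (lsuc ℓ)
IsNonLosing x S K π = IsWinning x S K π ⊎ IsDraw π

------------------------------------------------------------------------
-- Strategies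

FPlay : Role → Hypergame ℓ → Pred (List (Hypergame ℓ)) (lsuc ℓ)
FPlay P x π = IsFinitePlay x (starter P) π × toMove (starter P) π ≡ side P

-- A partial function, given by its graph: π ↦ y stands for f(π) = y.  By `legal`,
-- y is an option of a position of x, hence a position of x.
record Strategy {ℓ} (P : Role) (x : Hypergame ℓ) : Set (lsuc (lsuc ℓ)) where
  field
    _↦_        : REL (List (Hypergame ℓ)) (Hypergame ℓ) (lsuc ℓ)
    respects   : ∀ {π π′ y y′} → Pointwise _≈_ π π′ → y ≈ y′ → π ↦ y → π′ ↦ y′
    functional : ∀ {π y y′} → π ↦ y → π ↦ y′ → y ≈ y′
    domain     : ∀ {π y} → π ↦ y → FPlay P x π
    legal      : ∀ {π y} → π ↦ y → IsFinitePlay x (starter P) (π ∷ʳ y)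
    defined    : ∀ {π} → FPlay P x π →
                 ∃[ y ] IsFinitePlay x (starter P) (π ∷ʳ y) → ∃[ y ] π ↦ y

IsCoherent : ∀ {P} {x : Hypergame ℓ} → Strategy P x → Sequence ℓ → Set (lsuc ℓ)
IsCoherent {P = P} f ρ =
  ∀ π → fin π ⊏ ρ → toMove (starter P) π ≡ side P →
  ∀ y → π ↦ y → fin (π ∷ʳ y) ⊑ ρ
  where open Strategy f

-- `IsProduct f g π`: π is the play f * g.  It exists and is unique, see
-- `product-exists-unique`.
record IsProduct {ℓ P} {x : Hypergame ℓ} (f : Strategy P x)
                 (g : Strategy (opponent P) x) (π : Sequence ℓ) : Set (lsuc ℓ) where
  field
    isPlay    : IsPlay x (starter P) π
    coherentˡ : IsCoherent f π
    coherentʳ : IsCoherent g π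
    maximal   : ∀ ρ → IsPlay x (starter P) ρ → IsCoherent f ρ → IsCoherent g ρ →
                π ⊑ ρ → ρ ⊑ π

IsNonLosingStrategy : ∀ {P} {x : Hypergame ℓ} → Strategy P x → Set (lsuc (lsuc ℓ))
IsNonLosingStrategy {P = P} {x} f =
  ∀ (g : Strategy (opponent P) x) π →
  IsProduct f g π → IsNonLosing x (starter P) (side P) π

data Player : Set where
  L R I II : Player

roles : Player → Role × Role
roles L  = (L , I)  , (L , II)
roles R  = (R , I)  , (R , II)
roles I  = (L , I)  , (R , I)
roles II = (L , II) , (R , II)

PlayerStrategy : Player → Hypergame ℓ → Set (lsuc (lsuc ℓ))
PlayerStrategy p x = Strategy (proj₁ (roles p)) x × Strategy (proj₂ (roles p)) x

IsNonLosingPlayerStrategy : ∀ p {x : Hypergame ℓ} → PlayerStrategy p x → Set (lsuc (lsuc ℓ))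
IsNonLosingPlayerStrategy p (f , g) = IsNonLosingStrategy f × IsNonLosingStrategy g

------------------------------------------------------------------------
-- Bisimilarity is an equivalence, and options respect it

≈-refl : {x : Hypergame ℓ} → x ≈ x
≈-refl = _≡_ , (λ { refl K → (λ o → _ , o , refl) , (λ o → _ , o , refl) }) , refl

≈-sym : {x y : Hypergame ℓ} → x ≈ y → y ≈ x
≈-sym (B , bis , r) =
  (λ m n → B n m) , (λ b K → proj₂ (bis b K) , proj₁ (bis b K)) , r

≈-trans : {x y z : Hypergame ℓ} → x ≈ y → y ≈ z → x ≈ z
≈-trans {x = x} {y} {z} (B , bisB , r) (C , bisC , s) =
  B∘C , (λ (m , b , c) K → forth b c K , back b c K) , (root y , r , s)
  where
  B∘C : REL (Node x) (Node z) _
  B∘C n k = ∃[ m ] (B n m × C m k)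

  forth : ∀ {n m k} → B n m → C m k → ∀ K {n′} → Opt x K n n′ →
          ∃[ k′ ] (Opt z K k k′ × B∘C n′ k′)
  forth b c K o with proj₁ (bisB b K) o
  ... | m′ , o′ , b′ with proj₁ (bisC c K) o′
  ... | k′ , o″ , c′ = k′ , o″ , m′ , b′ , c′

  back : ∀ {n m k} → B n m → C m k → ∀ K {k′} → Opt z K k k′ →
         ∃[ n′ ] (Opt x K n n′ × B∘C n′ k′)
  back b c K o with proj₂ (bisC c K) o
  ... | m′ , o′ , c′ with proj₂ (bisB b K) o′
  ... | n′ , o″ , b′ = n′ , o″ , m′ , b′ , c′

options-resp : ∀ {K} {x x′ y y′ : Hypergame ℓ} →
               x ≈ x′ → y ≈ y′ → options K x y → options K x′ y′
options-resp {K = K} {x} {x′} (B , bis , r) q (n , o , e) with proj₁ (bis r K) o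
... | n′ , o′ , r′ = n′ , o′ , ≈-trans (≈-sym q) (≈-trans e (B , bis , r′))

------------------------------------------------------------------------
-- Existence and uniqueness of f * g

_≈*_ : Rel (List (Hypergame ℓ)) (lsuc ℓ)
_≈*_ = Pointwise _≈_

≈*-sym : {π ρ : List (Hypergame ℓ)} → π ≈* ρ → ρ ≈* π
≈*-sym = Pointwise.symmetric ≈-sym

≈*-refl : {π : List (Hypergame ℓ)} → π ≈* π
≈*-refl = Pointwise.refl ≈-refl

∷ʳ-cong : {π ρ : List (Hypergame ℓ)} {y z : Hypergame ℓ} →
          π ≈* ρ → y ≈ z → (π ∷ʳ y) ≈* (ρ ∷ʳ z)
∷ʳ-cong ps q = Pointwise.++⁺ ps (q ∷ [])

play-prefix : {x x′ : Hypergame ℓ} {K : Side} {π ρ : List (Hypergame ℓ)} →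
              x ≈ x′ → Prefix _≈_ π ρ → IsFinitePlay x K ρ → IsFinitePlay x′ K π
play-prefix q []       _        = []
play-prefix q (p ∷ ps) (o ∷ os) =
  options-resp q (≈-sym p) o ∷ play-prefix (≈-sym p) ps os

≈*⇒prefix : {π ρ : List (Hypergame ℓ)} → π ≈* ρ → Prefix _≈_ π ρ
≈*⇒prefix []       = []
≈*⇒prefix (p ∷ ps) = p ∷ ≈*⇒prefix ps

prefix-antisym : {π ρ : List (Hypergame ℓ)} →
                 Prefix _≈_ π ρ → Prefix _≈_ ρ π → π ≈* ρ
prefix-antisym []       []       = []
prefix-antisym (p ∷ ps) (_ ∷ qs) = p ∷ prefix-antisym ps qs

prefix-∷ʳ : {π ρ : List (Hypergame ℓ)} {z : Hypergame ℓ} →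
            Prefix _≈_ π ρ → Prefix _≈_ π (ρ ∷ʳ z)
prefix-∷ʳ []       = []
prefix-∷ʳ (p ∷ ps) = p ∷ prefix-∷ʳ ps

prefix-∷ʳ⁻ : ∀ {π} (ρ : List (Hypergame ℓ)) {z} → Prefix _≈_ π (ρ ∷ʳ z) →
             Prefix _≈_ π ρ ⊎ π ≈* (ρ ∷ʳ z)
prefix-∷ʳ⁻ []      []           = inj₁ []
prefix-∷ʳ⁻ []      (p ∷ [])     = inj₂ (p ∷ [])
prefix-∷ʳ⁻ (_ ∷ ρ) []           = inj₁ []
prefix-∷ʳ⁻ (_ ∷ ρ) (p ∷ ps) with prefix-∷ʳ⁻ ρ ps
... | inj₁ qs = inj₁ (p ∷ qs)
... | inj₂ qs = inj₂ (p ∷ qs)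

proper-prefix : {π ρ : List (Hypergame ℓ)} → Prefix _≈_ π ρ → ¬ Prefix _≈_ ρ π →
                ∃[ y ] Prefix _≈_ (π ∷ʳ y) ρ
proper-prefix {ρ = []}    []       ¬p = contradiction [] ¬p
proper-prefix {ρ = y ∷ _} []       ¬p = y , ≈-refl ∷ []
proper-prefix (p ∷ ps) ¬p
  with proper-prefix ps (λ qs → ¬p (≈-sym p ∷ qs))
... | y , qs = y , p ∷ qs

length-∷ʳ : ∀ (π : List (Hypergame ℓ)) y → length (π ∷ʳ y) ≡ suc (length π)
length-∷ʳ π y = trans (length-++ π) (+-comm (length π) 1)

∷ʳ-⊑-inf : ∀ {π : List (Hypergame ℓ)} {σ : ℕ → Hypergame ℓ} {y} →
           fin π ⊑ inf σ → y ≈ σ (length π) → fin (π ∷ʳ y) ⊑ inf σ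
∷ʳ-⊑-inf {π = π} {σ} {y} ps q =
  subst ((π ∷ʳ y) ≈*_)
    (trans (applyUpTo-∷ʳ σ (length π)) (cong (applyUpTo σ) (sym (length-∷ʳ π y))))
    (∷ʳ-cong ps q)

∷ʳ-⊑-inf⁻ : ∀ (π : List (Hypergame ℓ)) {σ : ℕ → Hypergame ℓ} {y} →
            fin (π ∷ʳ y) ⊑ inf σ → y ≈ σ (length π)
∷ʳ-⊑-inf⁻ []      (p ∷ _)  = p
∷ʳ-⊑-inf⁻ (_ ∷ π) (_ ∷ ps) = ∷ʳ-⊑-inf⁻ π ps

prefix-applyUpTo : ∀ {π : List (Hypergame ℓ)} σ n →
                   Prefix _≈_ π (applyUpTo σ n) → fin π ⊑ inf σ
prefix-applyUpTo σ zero    []       = []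
prefix-applyUpTo σ (suc n) []       = []
prefix-applyUpTo σ (suc n) (p ∷ ps) = p ∷ prefix-applyUpTo (λ k → σ (suc k)) n ps

play-step : ∀ {x : Hypergame ℓ} {K π} ρ → IsPlay x K ρ → fin π ⊏ ρ →
            ∃[ y ] IsFinitePlay x K (π ∷ʳ y)
play-step (fin ρ) isPlay (p , ¬p) with proper-prefix p ¬p
... | y , q = y , play-prefix ≈-refl q isPlay
play-step {π = π} (inf σ) isPlay (p , _) =
  σ (length π) ,
  play-prefix ≈-refl (≈*⇒prefix (∷ʳ-⊑-inf {π = π} {σ} p ≈-refl)) (isPlay _)

starter-opponent : ∀ P → starter (opponent P) ≡ starter P
starter-opponent (L , I)  = refl
starter-opponent (L , II) = refl
starter-opponent (R , I)  = refl
starter-opponent (R , II) = refl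

side-opponent : ∀ P → side (opponent P) ≡ other (side P)
side-opponent (_ , I)  = refl
side-opponent (_ , II) = refl

either : ∀ J K → J ≡ K ⊎ J ≡ other K
either L L = inj₁ refl
either L R = inj₂ refl
either R L = inj₂ refl
either R R = inj₁ refl

not-both : ∀ {J} K → J ≡ K → ¬ J ≡ other K
not-both L refl ()
not-both R refl ()

module _ (em : ExcludedMiddle (lsuc ℓ)) {P : Role} {x : Hypergame ℓ}
         (f : Strategy P x) (g : Strategy (opponent P) x) where

  private
    module f = Strategy f
    module g = Strategy g

    S : Side
    S = starter P

    Next : REL (List (Hypergame ℓ)) (Hypergame ℓ) (lsuc ℓ)
    Next π y = π f.↦ y ⊎ π g.↦ y

    g-toMove : ∀ {π y} → π g.↦ y → toMove S π ≡ other (side P)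
    g-toMove {π} m = trans (cong (λ K → toMove K π) (sym (starter-opponent P)))
                           (trans (proj₂ (g.domain m)) (side-opponent P))

    next-functional : ∀ {π π′ y y′} → π ≈* π′ → Next π y → Next π′ y′ → y ≈ y′
    next-functional ps (inj₁ m) (inj₁ m′) = f.functional (f.respects ps ≈-refl m) m′
    next-functional ps (inj₂ m) (inj₂ m′) = g.functional (g.respects ps ≈-refl m) m′
    next-functional ps (inj₁ m) (inj₂ m′) =
      contradiction (g-toMove m′)
        (not-both (side P) (proj₂ (f.domain (f.respects ps ≈-refl m))))
    next-functional ps (inj₂ m) (inj₁ m′) =
      contradiction (g-toMove (g.respects ps ≈-refl m))
        (not-both (side P) (proj₂ (f.domain m′)))

    next-legal : ∀ {π y} → Next π y → IsFinitePlay x S (π ∷ʳ y)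
    next-legal (inj₁ m) = f.legal m
    next-legal (inj₂ m) = subst (λ K → IsFinitePlay x K _) (starter-opponent P) (g.legal m)

    Moves : List (Hypergame ℓ) → Set (lsuc ℓ)
    Moves π = ∃[ y ] IsFinitePlay x S (π ∷ʳ y)

    next-defined : ∀ {π} → IsFinitePlay x S π → Moves π → ∃[ y ] Next π y
    next-defined {π} p (y , q) with either (toMove S π) (side P)
    ... | inj₁ e with f.defined (p , e) (y , q)
    ...   | z , m = z , inj₁ m
    next-defined {π} p (y , q) | inj₂ e
      with g.defined
             (subst (λ K → IsFinitePlay x K π) (sym (starter-opponent P)) p ,
              trans (cong (λ K → toMove K π) (starter-opponent P))
                    (trans e (sym (side-opponent P))))
             (y , subst (λ K → IsFinitePlay x K _) (sym (starter-opponent P)) q)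
    ... | z , m = z , inj₂ m

    Coherent : Sequence ℓ → Set (lsuc ℓ)
    Coherent ρ = ∀ π → fin π ⊏ ρ → ∀ y → Next π y → fin (π ∷ʳ y) ⊑ ρ

    coherent⁺ : ∀ {ρ} → IsCoherent f ρ → IsCoherent g ρ → Coherent ρ
    coherent⁺ cf cg π p y (inj₁ m) = cf π p (proj₂ (f.domain m)) y m
    coherent⁺ cf cg π p y (inj₂ m) = cg π p (proj₂ (g.domain m)) y m

    data Built : List (Hypergame ℓ) → Set (lsuc ℓ) where
      []   : Built []
      step : ∀ {π y} → Built π → Next π y → Built (π ∷ʳ y)

    built-play : ∀ {π} → Built π → IsFinitePlay x S π
    built-play []         = []
    built-play (step _ m) = next-legal m

    built-coherent : ∀ {π} → Built π → Coherent (fin π)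
    built-coherent []                 _ ([] , ¬p) = contradiction [] ¬p
    built-coherent (step {π} {z} b m) κ (p , ¬p) y n with prefix-∷ʳ⁻ π p
    ... | inj₂ q = contradiction (≈*⇒prefix (≈*-sym q)) ¬p
    ... | inj₁ q with em {Prefix _≈_ π κ}
    ...   | yes r = ≈*⇒prefix (∷ʳ-cong κ≈π (next-functional κ≈π n m))
      where
      κ≈π : κ ≈* π
      κ≈π = prefix-antisym q r
    ...   | no ¬r = prefix-∷ʳ (built-coherent b κ (q , ¬r) y n)

    built-compare : ∀ {π} → Built π → ∀ ρ → Coherent ρ → fin π ⊑ ρ ⊎ ρ ⊑ fin π
    built-compare []         (fin ρ) c = inj₁ []
    built-compare []         (inf σ) c = inj₁ []
    built-compare (step {π} b m) ρ c with em {ρ ⊑ fin π}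
    ... | yes p = inj₂ (lemma ρ p)
      where
      lemma : ∀ ρ → ρ ⊑ fin π → ρ ⊑ fin (π ∷ʳ _)
      lemma (fin ρ) p = prefix-∷ʳ p
    ... | no ¬p with built-compare b ρ c
    ...   | inj₁ q = inj₁ (c _ (q , ¬p) _ m)
    ...   | inj₂ q = contradiction q ¬p

    record IsGreatest (π : Sequence ℓ) : Set (lsuc ℓ) where
      field
        isPlay   : IsPlay x S π
        coherent : Coherent π
        greatest : ∀ ρ → IsPlay x S ρ → Coherent ρ → ρ ⊑ π

    greatest-fin : ∀ {π} → Built π → ¬ Moves π → IsGreatest (fin π)
    greatest-fin {π} b stuck = record
      { isPlay = built-play b ; coherent = built-coherent b ; greatest = great }
      where
      great : ∀ ρ → IsPlay x S ρ → Coherent ρ → ρ ⊑ fin π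
      great ρ p c with em {ρ ⊑ fin π}
      ... | yes q = q
      ... | no ¬q with built-compare b ρ c
      ...   | inj₁ q = contradiction (play-step ρ p (q , ¬q)) stuck
      ...   | inj₂ q = q

    module Infinite (moves : ∀ {π} → Built π → Moves π) where

      next : (b : ∃ Built) → ∃[ y ] Next (proj₁ b) y
      next (π , b) = next-defined (built-play b) (moves b)

      stage : ℕ → ∃ Built
      stage zero    = [] , []
      stage (suc n) = _ , step (proj₂ (stage n)) (proj₂ (next (stage n)))

      σ : ℕ → Hypergame ℓ
      σ n = proj₁ (next (stage n))

      stage≡ : ∀ n → proj₁ (stage n) ≡ applyUpTo σ n
      stage≡ zero    = refl
      stage≡ (suc n) = trans (cong (_∷ʳ σ n) (stage≡ n)) (applyUpTo-∷ʳ σ n)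

      coherent : Coherent (inf σ)
      coherent κ (p , _) y m = ∷ʳ-⊑-inf {π = κ} {σ} p
        (next-functional (subst (κ ≈*_) (sym (stage≡ (length κ))) p) m
          (proj₂ (next (stage (length κ)))))

      stage-length : ∀ n → length (proj₁ (stage n)) ≡ n
      stage-length n = trans (cong length (stage≡ n)) (length-applyUpTo σ n)

      great : ∀ ρ → Coherent ρ → ρ ⊑ inf σ
      great ρ c with em {∃[ n ] (ρ ⊑ fin (proj₁ (stage n)))}
      great (fin ρ) c | yes (n , p) =
        prefix-applyUpTo σ n (subst (Prefix _≈_ ρ) (stage≡ n) p)
      great ρ c | no ¬p = above ρ longer
        where
        longer : ∀ n → fin (proj₁ (stage n)) ⊑ ρ
        longer n with built-compare (proj₂ (stage n)) ρ c
        ... | inj₁ q = q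
        ... | inj₂ q = contradiction (n , q) ¬p

        above : ∀ ρ → (∀ n → fin (proj₁ (stage n)) ⊑ ρ) → ρ ⊑ inf σ
        above (fin ρ) h =
          contradiction
            (subst (_≤ length ρ) (stage-length _) (length-mono (h (suc (length ρ)))))
            (<⇒≱ (n<1+n _))
        above (inf τ) h n =
          ≈-sym (subst (λ k → σ n ≈ τ k) (stage-length n)
                       (∷ʳ-⊑-inf⁻ (proj₁ (stage n)) (h (suc n))))

      greatest : IsGreatest (inf σ)
      greatest = record
        { isPlay   = λ n → subst (IsFinitePlay x S) (stage≡ n) (built-play (proj₂ (stage n)))
        ; coherent = coherent
        ; greatest = λ ρ _ → great ρ
        }

    ∃-greatest : ∃ IsGreatest
    ∃-greatest with em {∃[ π ] (Built π × ¬ Moves π)}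
    ... | yes (π , b , stuck) = fin π , greatest-fin b stuck
    ... | no ¬stuck           = _ , Infinite.greatest moves
      where
      moves : ∀ {π} → Built π → Moves π
      moves {π} b with em {Moves π}
      ... | yes m = m
      ... | no ¬m = contradiction (π , b , ¬m) ¬stuck

  product-exists-unique : ∃! _≋_ (IsProduct f g)
  product-exists-unique with ∃-greatest
  ... | π , gr = π , isProduct , unique
    where
    open IsGreatest gr

    isProduct : IsProduct f g π
    isProduct = record
      { isPlay    = isPlay
      ; coherentˡ = λ κ p _ y m → coherent κ p y (inj₁ m)
      ; coherentʳ = λ κ p _ y m → coherent κ p y (inj₂ m)
      ; maximal   = λ ρ p cf cg _ → greatest ρ p (coherent⁺ cf cg)
      }

    unique : ∀ {ρ} → IsProduct f g ρ → π ≋ ρ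
    unique {ρ} pr = P.maximal π isPlay (IsProduct.coherentˡ isProduct)
                      (IsProduct.coherentʳ isProduct) ρ⊑π , ρ⊑π
      where
      module P = IsProduct pr
      ρ⊑π : ρ ⊑ π
      ρ⊑π = greatest ρ P.isPlay (coherent⁺ P.coherentˡ P.coherentʳ)

{-# OPTIONS --safe #-}
module Submission where

-- Gale-Stewart determinacy for reachability games, with all infinite plays
-- drawn.  Fix who moves first.  Call a position doomed for K when the opponent
-- of K can force a win there: since a win is a finite play, this is an
-- inductively generated property of the position and of the side to move.  Two
-- facts carry the proof.
--
-- No position is doomed for both sides (`doomed-disjoint`): following the
-- winning moves of both sides at once would descend forever through two
-- well-founded derivations.
--
-- Where K is not doomed, K has a non-losing strategy (`non-losing`): if K is to
-- move, some option keeps K undoomed, and if the opponent is to move, all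
-- options do, so K can preserve this property forever.  The resulting play
-- either never ends, or ends where K is not the side that is stuck, since a
-- side that is to move and stuck is doomed.  Choosing the options to move to
-- takes the axiom of choice, for the positions of the game up to bisimilarity.
--
-- So of two opposing roles at least one has a non-losing strategy
-- (`role-or-opponent`).  This holds for LI against RII and for LII against RI,
-- and each of the four combinations of outcomes is one of the players L, I,
-- II, R.

open import Axiom.ExcludedMiddle using (ExcludedMiddle)
open import Data.Empty using (⊥-elim)
open import Data.List.Base using (List; []; _∷_; _∷ʳ_; length)
open import Data.List.Relation.Binary.Pointwise using ([]; _∷_)
open import Data.List.Relation.Binary.Prefix.Heterogeneous using (Prefix; []; _∷_)
open import Data.List.Relation.Binary.Prefix.Heterogeneous.Properties using (length-mono)
open import Data.List.Reverse using (Reverse; []; _∶_∶ʳ_; reverseView)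
open import Data.Nat.Base using (_≤_)
open import Data.Nat.Properties using (1+n≰n; ≤-trans)
open import Data.Product using (Σ-syntax; ∃-syntax; _×_; _,_; proj₁; proj₂)
open import Data.Sum.Base using (_⊎_; inj₁; inj₂)
open import Data.Unit.Polymorphic using (tt)
open import Function.Bundles using (Func)
open import Level using (Level; suc)
open import Relation.Binary.Bundles using (Setoid)
open import Relation.Binary.PropositionalEquality using (_≡_; _≢_; refl; sym; trans; cong; subst; subst₂)
open import Relation.Nullary using (¬_; yes; no; contradiction)
open import Relation.Unary using (Empty)
open import Defs

private
  variable
    ℓ : Level

-- Doomed positions

-- `Doomed K J x`: with J to move at x, the opponent of K forces a win.  The
-- side to move is an index with an explicit equation, not K or `other K`
-- itself, so that derivations for K and for `other K` can be compared.
data Doomed {ℓ} (K : Side) : Side → Hypergame ℓ → Set (suc ℓ) where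
  all-doomed  : ∀ {J x} → J ≡ K →
                (∀ {y} → options J x y → Doomed K (other J) y) → Doomed K J x
  some-doomed : ∀ {J x y} → J ≡ other K →
                options J x y → Doomed K (other J) y → Doomed K J x

-- Where one derivation says that all options are doomed for the side to move,
-- the other one names an option, so both derivations shrink simultaneously.
doomed-disjoint : ∀ {K J} {x : Hypergame ℓ} → Doomed K J x → ¬ Doomed (other K) J x
doomed-disjoint {K = K} (all-doomed e _)    (all-doomed e′ _)    = not-both K e e′
doomed-disjoint         (all-doomed _ h)    (some-doomed _ o d)  = doomed-disjoint (h o) d
doomed-disjoint         (some-doomed _ o d) (all-doomed _ h)     = doomed-disjoint d (h o)
doomed-disjoint {K = K} (some-doomed e _ _) (some-doomed e′ _ _) = not-both (other K) e e′

doomed-resp : ∀ {K J} {x x′ : Hypergame ℓ} → x ≈ x′ → Doomed K J x → Doomed K J x′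
doomed-resp q (all-doomed e h)    = all-doomed e (λ o → h (options-resp (≈-sym q) ≈-refl o))
doomed-resp q (some-doomed e o d) = some-doomed e (options-resp q ≈-refl o) d

undoomed-option : ExcludedMiddle (suc ℓ) → ∀ {K} {x : Hypergame ℓ} → ¬ Doomed K K x →
                  ∃[ y ] (options K x y × ¬ Doomed K (other K) y)
undoomed-option em {K} {x} ¬d with em {∃[ y ] (options K x y × ¬ Doomed K (other K) y)}
... | yes found = found
... | no  none  = contradiction (all-doomed refl doomed) ¬d
  where
  doomed : ∀ {y} → options K x y → Doomed K (other K) y
  doomed {y} o with em {Doomed K (other K) y}
  ... | yes d  = d
  ... | no ¬d′ = contradiction (y , o , ¬d′) none

-- Finite plays and their last moves

toMove-∷ʳ : ∀ J (π : List (Hypergame ℓ)) {y} → toMove J (π ∷ʳ y) ≡ other (toMove J π)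
toMove-∷ʳ J []      = refl
toMove-∷ʳ J (_ ∷ π) = toMove-∷ʳ (other J) π

end-∷ʳ : ∀ (x : Hypergame ℓ) π {y} → end x (π ∷ʳ y) ≡ y
end-∷ʳ x []      = refl
end-∷ʳ x (z ∷ π) = end-∷ʳ z π

toMove-resp : ∀ {J} {π ρ : List (Hypergame ℓ)} → π ≈* ρ → toMove J π ≡ toMove J ρ
toMove-resp []       = refl
toMove-resp (_ ∷ ps) = toMove-resp ps

end-resp : ∀ {x y : Hypergame ℓ} {π ρ} → x ≈ y → π ≈* ρ → end x π ≈ end y ρ
end-resp q []       = q
end-resp q (p ∷ ps) = end-resp p ps

play-∷ʳ : ∀ {x : Hypergame ℓ} {J π y} → IsFinitePlay x J π →
          options (toMove J π) (end x π) y → IsFinitePlay x J (π ∷ʳ y)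
play-∷ʳ []       o = o ∷ []
play-∷ʳ (p ∷ ps) o = p ∷ play-∷ʳ ps o

last-move : ∀ {x : Hypergame ℓ} {J} π {y} → IsFinitePlay x J (π ∷ʳ y) →
            options (toMove J π) (end x π) y
last-move []      (o ∷ []) = o
last-move (_ ∷ π) (_ ∷ os) = last-move π os

-- Every move leads to a node of the same coalgebra, up to bisimilarity.
end-position : ∀ (x : Hypergame ℓ) {y J π} n → y ≈ x at n → IsFinitePlay y J π →
               ∃[ m ] (end y π ≈ x at m)
end-position x n q []       = n , q
end-position x n q (o ∷ os) with options-resp q ≈-refl o
... | m , _ , e = end-position x m e os

prefix-init : ∀ (π : List (Hypergame ℓ)) {ρ y} → Prefix _≈_ (π ∷ʳ y) ρ → Prefix _≈_ π ρ
prefix-init []      _        = []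
prefix-init (_ ∷ π) (p ∷ ps) = p ∷ prefix-init π ps

prefix-last-unique : ∀ (π : List (Hypergame ℓ)) {ρ y z} →
                     Prefix _≈_ (π ∷ʳ y) ρ → Prefix _≈_ (π ∷ʳ z) ρ → y ≈ z
prefix-last-unique []      (p ∷ _)  (q ∷ _)  = ≈-trans p (≈-sym q)
prefix-last-unique (_ ∷ π) (_ ∷ ps) (_ ∷ qs) = prefix-last-unique π ps qs

∷ʳ-not-prefix : ∀ (π : List (Hypergame ℓ)) {y} → ¬ Prefix _≈_ (π ∷ʳ y) π
∷ʳ-not-prefix π p = 1+n≰n (subst (_≤ length π) (length-∷ʳ π _) (length-mono p))

init-proper : ∀ (π : List (Hypergame ℓ)) {ρ y} → Prefix _≈_ (π ∷ʳ y) ρ → fin π ⊏ fin ρ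
init-proper π p = prefix-init π p ,
  λ q → 1+n≰n (subst (_≤ length π) (length-∷ʳ π _) (≤-trans (length-mono p) (length-mono q)))

-- Finite products are stuck

coherent-∷ʳ : ExcludedMiddle (suc ℓ) →
              ∀ {P} {x : Hypergame ℓ} (f : Strategy P x) {π y} → IsCoherent f (fin π) →
              (∀ {z} → Strategy._↦_ f π z → z ≈ y) → IsCoherent f (fin (π ∷ʳ y))
coherent-∷ʳ em f {π} {y} c agrees κ (p , ¬p) t z m with prefix-∷ʳ⁻ π p
... | inj₂ q = contradiction (≈*⇒prefix (≈*-sym q)) ¬p
... | inj₁ q with em {Prefix _≈_ π κ}
...   | no ¬r = prefix-∷ʳ (c κ (q , ¬r) t z m)
...   | yes r = ≈*⇒prefix (∷ʳ-cong κ≈π (agrees (Strategy.respects f κ≈π ≈-refl m)))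
  where
  κ≈π : κ ≈* π
  κ≈π = prefix-antisym q r

-- Stated for any two roles with the same starter and different sides, so that
-- it applies to a role and its opponent in either order.
coherent-extension :
  ExcludedMiddle (suc ℓ) →
  ∀ {P Q} {x : Hypergame ℓ} (f : Strategy P x) (g : Strategy Q x) →
  starter P ≡ starter Q → side P ≢ side Q →
  ∀ {π y} → IsCoherent f (fin π) → IsCoherent g (fin π) → FPlay P x π →
  options (toMove (starter P) π) (end x π) y →
  ∃[ z ] (IsFinitePlay x (starter P) (π ∷ʳ z) ×
          IsCoherent f (fin (π ∷ʳ z)) × IsCoherent g (fin (π ∷ʳ z)))
coherent-extension em f g e ne {π} cf cg π∈ o
  with Strategy.defined f π∈ (_ , play-∷ʳ (proj₁ π∈) o)
... | z , m = z , Strategy.legal f m ,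
  coherent-∷ʳ em f cf (λ m′ → Strategy.functional f m′ m) ,
  coherent-∷ʳ em g cg (λ m′ → contradiction (same-side (proj₂ (Strategy.domain g m′))) ne)
  where
  same-side : ∀ {K} → toMove _ π ≡ K → _ ≡ K
  same-side t = trans (sym (proj₂ π∈)) (trans (cong (λ J → toMove J π) e) t)

-- If the side to move had an option, its strategy would prescribe one, and
-- appending it would give a longer coherent play, against maximality.
product-stuck : ExcludedMiddle (suc ℓ) →
                ∀ {P} {x : Hypergame ℓ} {f : Strategy P x} {g : Strategy (opponent P) x} {π} →
                IsProduct f g (fin π) → Empty (options (toMove (starter P) π) (end x π))
product-stuck em {P} {x} {f} {g} {π} prod y o = stuck (either (toMove (starter P) π) (side P))
  where
  open IsProduct prod

  same-starter : starter (opponent P) ≡ starter P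
  same-starter = starter-opponent P

  opposed : side P ≢ side (opponent P)
  opposed e = not-both (side P) refl (trans e (side-opponent P))

  no-extension : ∀ {z} → IsFinitePlay x (starter P) (π ∷ʳ z) →
                 IsCoherent f (fin (π ∷ʳ z)) → ¬ IsCoherent g (fin (π ∷ʳ z))
  no-extension p cf cg =
    ∷ʳ-not-prefix π (maximal (fin (π ∷ʳ _)) p cf cg (prefix-∷ʳ (≈*⇒prefix ≈*-refl)))

  stuck : ¬ (toMove (starter P) π ≡ side P ⊎ toMove (starter P) π ≡ other (side P))
  stuck (inj₁ t)
    with coherent-extension em f g (sym same-starter) opposed coherentˡ coherentʳ (isPlay , t) o
  ... | _ , p , cf , cg = no-extension p cf cg
  stuck (inj₂ t)
    with coherent-extension em g f same-starter (λ e → opposed (sym e)) coherentʳ coherentˡ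
           (subst (λ J → IsFinitePlay x J π) (sym same-starter) isPlay ,
            trans (cong (λ J → toMove J π) same-starter) (trans t (sym (side-opponent P))))
           (subst (λ J → options (toMove J π) (end x π) y) (sym same-starter) o)
  ... | _ , p , cg , cf =
    no-extension (subst (λ J → IsFinitePlay x J (π ∷ʳ _)) same-starter p) cf cg

-- Undoomed roles have non-losing strategies

positions : Hypergame ℓ → Setoid ℓ (suc ℓ)
positions x = record
  { Carrier       = Node x
  ; _≈_           = λ n m → x at n ≈ x at m
  ; isEquivalence = record { refl = ≈-refl ; sym = ≈-sym ; trans = ≈-trans }
  }

-- `GoodMove x K n m`: K does well to move from n to m.  This has to be
-- satisfiable everywhere, so it demands nothing where K cannot move; where K is
-- doomed any option will do, since a strategy must move even there.
GoodMove : (x : Hypergame ℓ) → Side → Node x → Node x → Set (suc ℓ)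
GoodMove x K n m =
  ∃[ y ] options K (x at n) y →
  options K (x at n) (x at m) × (¬ Doomed K K (x at n) → ¬ Doomed K (other K) (x at m))

goodMove-resp : ∀ (x : Hypergame ℓ) {K n n′ m m′} → x at n ≈ x at n′ → x at m ≈ x at m′ →
                GoodMove x K n m → GoodMove x K n′ m′
goodMove-resp x p q good (y , o) with good (y , options-resp (≈-sym p) ≈-refl o)
... | o′ , keeps =
  options-resp p q o′ ,
  λ ¬d d → keeps (λ d′ → ¬d (doomed-resp p d′)) (doomed-resp (≈-sym q) d)

∃-goodMove : ExcludedMiddle (suc ℓ) → ∀ (x : Hypergame ℓ) K n → ∃[ m ] GoodMove x K n m
∃-goodMove em x K n with em {Doomed K K (x at n)}
... | no ¬d with undoomed-option em ¬d
...   | y , (m , o , e) , ¬d′ =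
  m , λ _ → (m , o , ≈-refl) , λ _ d → ¬d′ (doomed-resp (≈-sym e) d)
∃-goodMove em x K n | yes d with em {∃[ y ] options K (x at n) y}
... | yes (y , m , o , _) = m , λ _ → (m , o , ≈-refl) , λ ¬d → contradiction d ¬d
... | no stuck            = n , λ moves → contradiction moves stuck

module _ (em : ExcludedMiddle (suc ℓ)) (P : Role) (x : Hypergame ℓ)
         (choice : Func (positions x) (positions x))
         (good : ∀ n → GoodMove x (side P) n (Func.to choice n)) where

  open Func choice using () renaming (to to move; cong to move-cong)

  private
    S K : Side
    S = starter P
    K = side P

  -- Always move from the end of the play, represented by a node n, to the
  -- chosen node for n.
  positional : Strategy P x
  positional = record
    { _↦_        = _↦_
    ; respects   = λ {π} {π′} ps q ((p , t) , o , n , e , c) →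
        (play-prefix ≈-refl (≈*⇒prefix (≈*-sym ps)) p , trans (sym (toMove-resp ps)) t) ,
        options-resp (end-resp ≈-refl ps) q o ,
        n , ≈-trans (≈-sym (end-resp ≈-refl ps)) e , ≈-trans (≈-sym q) c
    ; functional = λ (_ , _ , n , e , c) (_ , _ , n′ , e′ , c′) →
        ≈-trans c (≈-trans (move-cong (≈-trans (≈-sym e) e′)) (≈-sym c′))
    ; domain     = proj₁
    ; legal      = λ {π} {y} ((p , t) , o , _) →
        play-∷ʳ p (subst (λ J → options J (end x π) y) (sym t) o)
    ; defined    = defined
    }
    where
    _↦_ : List (Hypergame _) → Hypergame _ → Set _
    π ↦ y = FPlay P x π × options K (end x π) y ×
            ∃[ n ] (end x π ≈ x at n × y ≈ x at move n)

    defined : ∀ {π} → FPlay P x π → ∃[ y ] IsFinitePlay x S (π ∷ʳ y) → ∃[ y ] π ↦ y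
    defined {π} (p , t) (y , q) with end-position x (root x) ≈-refl p
    ... | n , e =
      x at move n , (p , t) , options-resp (≈-sym e) ≈-refl (proj₁ (good n (y , o))) ,
      n , e , ≈-refl
      where
      o : options K (x at n) y
      o = options-resp e ≈-refl (subst (λ J → options J (end x π) y) t (last-move π q))

  positional-keeps : ∀ {π y} → Strategy._↦_ positional π y →
                     ¬ Doomed K K (end x π) → ¬ Doomed K (other K) y
  positional-keeps (_ , o , n , e , c) ¬d d =
    proj₂ (good n (_ , options-resp e ≈-refl o))
      (λ d′ → ¬d (doomed-resp (≈-sym e) d′)) (doomed-resp c d)

  -- Induction on the length of κ: a move of K is the one that the strategy
  -- prescribes, and a move of the opponent cannot doom K, since K would have
  -- been doomed before it.
  undoomed-along : ¬ Doomed K S x → ∀ {π} → IsFinitePlay x S π → IsCoherent positional (fin π) →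
                   ∀ {κ} → Reverse κ → Prefix _≈_ κ π → ¬ Doomed K (toMove S κ) (end x κ)
  undoomed-along ¬d p c []              q = ¬d
  undoomed-along ¬d {π} p c (κ ∶ r ∶ʳ z) q d = step (either (toMove S κ) K)
    where
    before : ¬ Doomed K (toMove S κ) (end x κ)
    before = undoomed-along ¬d p c r (prefix-init κ q)

    after : Doomed K (other (toMove S κ)) z
    after = subst₂ (Doomed K) (toMove-∷ʳ S κ) (end-∷ʳ x κ) d

    κz-play : IsFinitePlay x S (κ ∷ʳ z)
    κz-play = play-prefix ≈-refl q p

    step : ¬ (toMove S κ ≡ K ⊎ toMove S κ ≡ other K)
    step (inj₂ t) = before (some-doomed t (last-move κ κz-play) after)
    step (inj₁ t)
      with Strategy.defined positional
             (play-prefix ≈-refl (prefix-init κ q) p , t) (z , κz-play)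
    ... | y , m =
      positional-keeps m (subst (λ J → ¬ Doomed K J (end x κ)) t before)
        (subst (λ J → Doomed K (other J) y) t
          (doomed-resp (prefix-last-unique κ q (c κ (init-proper κ q) t y m)) after))

  positional-non-losing : ¬ Doomed K S x → IsNonLosingStrategy positional
  positional-non-losing ¬d g (inf σ) prod = inj₂ tt
  positional-non-losing ¬d g (fin π) prod with either (toMove S π) K
  ... | inj₂ t = inj₁ (t , subst (λ J → Empty (options J (end x π))) t (product-stuck em prod))
  ... | inj₁ t = contradiction (all-doomed t (λ {y} o → ⊥-elim (product-stuck em prod y o)))
    (undoomed-along ¬d isPlay coherentˡ (reverseView π) (≈*⇒prefix ≈*-refl))
    where open IsProduct prod

HasNonLosingStrategy : Role → Hypergame ℓ → Set (suc (suc ℓ))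
HasNonLosingStrategy P x = Σ[ f ∈ Strategy P x ] IsNonLosingStrategy f

module _ (em : ExcludedMiddle (suc ℓ)) (ac : AxiomOfChoice ℓ (suc ℓ)) (x : Hypergame ℓ) where

  non-losing : ∀ P → ¬ Doomed (side P) (starter P) x → HasNonLosingStrategy P x
  non-losing P ¬d with ac (positions x) (positions x) (GoodMove x (side P))
                          (goodMove-resp x) (∃-goodMove em x (side P))
  ... | choice , good =
    positional em P x choice good , positional-non-losing em P x choice good ¬d

  role-or-opponent : ∀ P → HasNonLosingStrategy P x ⊎ HasNonLosingStrategy (opponent P) x
  role-or-opponent P with em {Doomed (side P) (starter P) x}
  ... | no ¬d = inj₁ (non-losing P ¬d)
  ... | yes d = inj₂ (non-losing (opponent P)
    (subst₂ (λ K J → ¬ Doomed K J x) (sym (side-opponent P)) (sym (starter-opponent P))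
      (doomed-disjoint d)))

theorem2p13 : ∀ {ℓ : Level} →
    ExcludedMiddle (suc ℓ) → AxiomOfChoice ℓ (suc ℓ) →
    (x : Hypergame ℓ) →
    ∃[ p ] Σ[ f ∈ PlayerStrategy p x ] IsNonLosingPlayerStrategy p f
theorem2p13 em ac x with role-or-opponent em ac x (L , I) | role-or-opponent em ac x (L , II)
... | inj₁ (f , nf) | inj₁ (g , ng) = L  , (f , g) , (nf , ng)
... | inj₁ (f , nf) | inj₂ (g , ng) = I  , (f , g) , (nf , ng)
... | inj₂ (f , nf) | inj₁ (g , ng) = II , (g , f) , (ng , nf)
... | inj₂ (f , nf) | inj₂ (g , ng) = R  , (g , f) , (ng , nf)
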